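{- Let $P.\phi$ be a DQBF with prefix $P=\forall x_1,\dots,x_n\,\exists y_1(D_1),\dots,y_k(D_k)$ for $X$ and $Y$, and let $G_{\mathrm{sem}}$ be a semantic symmetry group for $P.\phi$. If $\psi\in\operatorname{BF}(X\cup Y)$ is a conjunctive symmetry breaker for $G_{\mathrm{sem}}$, then $P.\phi$ is true if and only if $P.(\phi\wedge\psi)$ is true.
   Context: $X=\{x_1,\dots,x_n\}$ and $Y=\{y_1,\dots,y_k\}$ are finite disjoint sets of propositional variables. For $V\subseteq X\cup Y$, $\operatorname{BF}(V)$ is the set of all propositional formulas built from $\top,\bot$, the variables in $V$ and the usual connectives. An assignment for $V$ is a function $\sigma:V\to\{\top,\bot\}$; $\mathcal A(V)$ is the set of all of them and $[\phi]_\sigma$ is the truth value of $\phi$ under $\sigma$. A prefix is $P=\forall x_1,\dots,x_n\,\exists y_1(D_1),\dots,y_k(D_k)$ with dependency sets $D_j\subseteq X$; for $\phi\in\operatorname{BF}(X\cup Y)$, $P.\phi$ is a DQBF. An interpretation for $P$ is a tuple $s=(s_1,\dots,s_k)$ of Boolean functions $s_j:\{\top,\bot\}^{|D_j|}\to\{\top,\bot\}$ (each can be represented by a formula in $\operatorname{BF}(D_j)$); $\mathcal S(P)$ is the set of interpretations. For $\sigma\in\mathcal A(X)$ and $s\in\mathcal S(P)$, the induced assignment $\sigma_s\in\mathcal A(X\cup Y)$ agrees with $\sigma$ on $X$ and sets $\sigma_s(y_j)=s_j(\sigma(x_{i_1}),\dots,\sigma(x_{i_d}))$ where $D_j=\{x_{i_1},\dots,x_{i_d}\}$,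 $i_1<\dots<i_d$. The truth value of $P.\phi$ under $s$ is $[P.\phi]_s=\bigwedge_{\sigma\in\mathcal A(X)}[\phi]_{\sigma_s}$; $P.\phi$ is true if some $s$ has $[P.\phi]_s=\top$ (such $s$ is a model). A semantic symmetry group for $P.\phi$ is a group (under composition) $G$ of bijections $\mathcal S(P)\to\mathcal S(P)$ such that $[P.\phi]_s=[P.\phi]_{g(s)}$ for all $g\in G$, $s\in\mathcal S(P)$. Given a group $G_{\mathrm{sem}}$ of bijections $\mathcal S(P)\to\mathcal S(P)$, a formula $\psi\in\operatorname{BF}(X\cup Y)$ is a conjunctive symmetry breaker for $G_{\mathrm{sem}}$ if for every $s\in\mathcal S(P)$ there is $g\in G_{\mathrm{sem}}$ with $[P.\psi]_{g(s)}=\top$. -}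

module Defs where

open import Data.Bool.Base using (Bool; true; false; not; _xor_) renaming (_∧_ to _&&_; _∨_ to _||_)
open import Data.Bool.ListAction using (all)
open import Data.Fin.Base using (Fin; zero; suc)
open import Data.Fin.Subset using (Subset; inside; outside; ∣_∣)
open import Data.List.Base using (List; _∷_; []; _++_; map)
open import Data.List.Relation.Unary.Any using (Any; here)
import Data.List.Relation.Unary.Any as Any
import Data.List.Relation.Unary.Any.Properties as Any
open import Data.Nat.Base using (ℕ; zero; suc)
open import Data.Product.Base using (∃-syntax; _×_)
open import Data.Sum.Base using (_⊎_; [_,_]′)
open import Data.Vec.Base using (Vec; _∷_; []) renaming (map to mapᵛ)
import Data.Vec.Functional as Functional
open import Function.Base using (_∘_)
open import Function.Bundles using (Bijection)
import Function.Construct.Composition as Composition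
import Function.Construct.Identity as Identity
import Function.Construct.Symmetry as Symmetry
open import Function.Properties.Surjection using (injective⇒to⁻-cong)
open import Level using (Level; 0ℓ; _⊔_) renaming (suc to lsuc)
open import Relation.Binary.Bundles using (Setoid)
open import Relation.Binary.PropositionalEquality using (_≡_; _≗_; refl; sym; trans)
open import Relation.Unary using (Pred; _∈_)

infix  9 ¬_
infixr 8 _∧_
infixr 7 _∨_
infixr 6 _⇒_
infix  5 _⇔_
infix  4 _∙_

data BF (V : Set) : Set where
  ⊤ ⊥         : BF V
  var         : V → BF V
  ¬_          : BF V → BF V
  _∧_ _∨_     : BF V → BF V → BF V
  _⇒_ _⇔_     : BF V → BF V → BF V

Assignment : Set → Set
Assignment V = V → Bool

[_]_ : {V : Set} → BF V → Assignment V → Bool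
[ ⊤ ]     σ = true
[ ⊥ ]     σ = false
[ var v ] σ = σ v
[ ¬ φ ]   σ = not ([ φ ] σ)
[ φ ∧ ψ ] σ = [ φ ] σ && [ ψ ] σ
[ φ ∨ ψ ] σ = [ φ ] σ || [ ψ ] σ
[ φ ⇒ ψ ] σ = not ([ φ ] σ) || [ ψ ] σ
[ φ ⇔ ψ ] σ = not ([ φ ] σ xor [ ψ ] σ)

assignments : (n : ℕ) → List (Assignment (Fin n))
assignments zero    = Functional.[] ∷ []
assignments (suc n) = map (true Functional.∷_) (assignments n) ++ map (false Functional.∷_) (assignments n)

-- The list is exhaustive (up to pointwise equality), so that a conjunction
-- over it is a conjunction over all assignments.
assignments-complete : ∀ {n} (σ : Assignment (Fin n)) → Any (σ ≗_) (assignments n)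
assignments-complete {zero}  σ = here λ ()
assignments-complete {suc n} σ with σ zero in eq
... | true  = Any.++⁺ˡ (Any.map⁺ (Any.map (λ p → λ { zero → eq ; (suc i) → p i }) (assignments-complete (σ ∘ suc))))
... | false = Any.++⁺ʳ (map (true Functional.∷_) (assignments n))
                (Any.map⁺ (Any.map (λ p → λ { zero → eq ; (suc i) → p i }) (assignments-complete (σ ∘ suc))))

-- X = {x₁,…,xₙ} and Y = {y₁,…,yₖ} are Fin n and Fin k; X ∪ Y is their disjoint union.
Var : ℕ → ℕ → Set
Var n k = Fin n ⊎ Fin k

record Prefix (n k : ℕ) : Set where
  constructor ∀∃
  field
    D : Fin k → Subset n

record DQBF (n k : ℕ) : Set where
  constructor _∙_
  field
    prefix : Prefix n k
    matrix : BF (Var n k)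

elements : ∀ {n} (p : Subset n) → Vec (Fin n) ∣ p ∣
elements []            = []
elements (inside  ∷ p) = zero ∷ mapᵛ suc (elements p)
elements (outside ∷ p) = mapᵛ suc (elements p)

module _ {n k : ℕ} (P : Prefix n k) where
  open Prefix P

  Interpretation : Set
  Interpretation = (j : Fin k) → Vec Bool ∣ D j ∣ → Bool

  -- 𝒮(P): interpretations are equal when their components are equal as functions.
  𝒮 : Setoid 0ℓ 0ℓ
  𝒮 = record
    { Carrier       = Interpretation
    ; _≈_           = λ s t → ∀ j → s j ≗ t j
    ; isEquivalence = record
      { refl  = λ j v → refl
      ; sym   = λ p j v → sym (p j v)
      ; trans = λ p q j v → trans (p j v) (q j v)
      }
    }

  -- The assignment σₛ.
  induced : Assignment (Fin n) → Interpretation → Assignment (Var n k)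
  induced σ s = [ σ , (λ j → s j (mapᵛ σ (elements (D j)))) ]′

module _ {n k : ℕ} where

  ⟦_⟧ : (F : DQBF n k) → Interpretation (DQBF.prefix F) → Bool
  ⟦ P ∙ φ ⟧ s = all (λ σ → [ φ ] (induced P σ s)) (assignments n)

  IsTrue : DQBF n k → Set
  IsTrue F = ∃[ s ] ⟦ F ⟧ s ≡ true

module _ {c e : Level} (S : Setoid c e) where
  open Setoid S

  inverse : Bijection S S → Bijection S S
  inverse g = Symmetry.bijection g (injective⇒to⁻-cong (Bijection.surjection g) (Bijection.injective g))

  -- A group of bijections S → S under composition, given as a set of bijections
  -- (a predicate respecting pointwise equality) closed under the group operations.
  record BijectionGroup (ℓ : Level) : Set (c ⊔ e ⊔ lsuc ℓ) where
    field
      Member    : Pred (Bijection S S) ℓ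
      resp      : ∀ {g h} → (∀ s → Bijection.to g s ≈ Bijection.to h s) → g ∈ Member → h ∈ Member
      id-closed : Identity.bijection S ∈ Member
      ∘-closed  : ∀ {g h} → g ∈ Member → h ∈ Member → Composition.bijection g h ∈ Member
      ⁻¹-closed : ∀ {g} → g ∈ Member → inverse g ∈ Member

module _ {n k : ℕ} {ℓ : Level} where
  open BijectionGroup using (Member)
  open Bijection using (to)

  IsSemanticSymmetryGroup : (F : DQBF n k) → BijectionGroup (𝒮 (DQBF.prefix F)) ℓ → Set ℓ
  IsSemanticSymmetryGroup F G = ∀ g → g ∈ Member G → ∀ s → ⟦ F ⟧ s ≡ ⟦ F ⟧ (to g s)

  IsConjunctiveSymmetryBreaker : (P : Prefix n k) → BijectionGroup (𝒮 P) ℓ → BF (Var n k) → Set ℓ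
  IsConjunctiveSymmetryBreaker P G ψ = ∀ s → ∃[ g ] g ∈ Member G × ⟦ P ∙ ψ ⟧ (to g s) ≡ true

{-# OPTIONS --safe #-}
module Submission where

open import Defs
open import Algebra.Bundles using (CommutativeMonoid)
import Algebra.Properties.CommutativeSemigroup as CommutativeSemigroupProperties
open import Data.Bool.Base using (Bool) renaming (_∧_ to _&&_)
open import Data.Bool.ListAction using (all)
open import Data.Bool.Properties using (∧-commutativeMonoid; ∧-conicalˡ)
open import Data.List.Base using (List; []; _∷_)
open import Data.Nat.Base using (ℕ)
open import Data.Product.Base using (_,_)
open import Function.Bundles using (mk⇔; Bijection)
open import Level using (Level)
open import Function.Bundles using () renaming (_⇔_ to _iff_)
open import Relation.Binary.PropositionalEquality using (_≡_; refl; sym; trans; cong; cong₂)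

open CommutativeSemigroupProperties (CommutativeMonoid.commutativeSemigroup ∧-commutativeMonoid) using (interchange)

-- The truth value under an interpretation is a conjunction over all universal assignments, and
-- conjunctions distribute over `_&&_`. Hence the models of `P ∙ (φ ∧ ψ)` are exactly the common
-- models of `P ∙ φ` and `P ∙ ψ` (`⟦⟧-∧`). Every orbit of the group meets the models of `P ∙ ψ`, and
-- the models of `P ∙ φ` are a union of orbits, so a model of `P ∙ φ` can be moved to a common
-- model.

all-∧ : {a : Level} {A : Set a} (p q : A → Bool) (xs : List A) →
  all (λ x → p x && q x) xs ≡ all p xs && all q xs
all-∧ p q []       = refl
all-∧ p q (x ∷ xs) = trans (cong ((p x && q x) &&_) (all-∧ p q xs)) (interchange (p x) (q x) (all p xs) (all q xs))

-- The induced assignment depends on the prefix and `s` but not on the matrix, so both conjuncts are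
-- evaluated at the same points and `all-∧` applies.
⟦⟧-∧ : {n k : ℕ} (P : Prefix n k) (φ ψ : BF (Var n k)) (s : Interpretation P) →
  ⟦ P ∙ (φ ∧ ψ) ⟧ s ≡ ⟦ P ∙ φ ⟧ s && ⟦ P ∙ ψ ⟧ s
⟦⟧-∧ {n} P φ ψ s = all-∧ (λ σ → [ φ ] (induced P σ s)) (λ σ → [ ψ ] (induced P σ s)) (assignments n)

theorem1 : {ℓ : Level} {n k : ℕ} (P : Prefix n k) (φ : BF (Var n k))
    (G : BijectionGroup (𝒮 P) ℓ) → IsSemanticSymmetryGroup (P ∙ φ) G →
    (ψ : BF (Var n k)) → IsConjunctiveSymmetryBreaker P G ψ →
    IsTrue (P ∙ φ) iff IsTrue (P ∙ (φ ∧ ψ))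
theorem1 P φ G symmetric ψ breaks = mk⇔ breakModel dropBreaker
  where
  breakModel : IsTrue (P ∙ φ) → IsTrue (P ∙ (φ ∧ ψ))
  breakModel (s , s⊨φ) with breaks s
  -- The model `s` itself may violate `P ∙ ψ`; its image `gs` satisfies it by choice of `g`, and
  -- remains a model of `P ∙ φ` by symmetry.
  ... | g , g∈G , gs⊨ψ = gs , trans (⟦⟧-∧ P φ ψ gs) (cong₂ _&&_ (trans (sym (symmetric g g∈G s)) s⊨φ) gs⊨ψ)
    where gs = Bijection.to g s

  dropBreaker : IsTrue (P ∙ (φ ∧ ψ)) → IsTrue (P ∙ φ)
  dropBreaker (s , s⊨φ∧ψ) = s , ∧-conicalˡ _ _ (trans (sym (⟦⟧-∧ P φ ψ s)) s⊨φ∧ψ)
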